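{- Let the OWA weights be nonincreasing, i.e. $w_1\ge w_2\ge\dots\ge w_K$. For each element $e_i\in E$ let $\hat c_{i1}\ge\hat c_{i2}\ge\dots\ge\hat c_{iK}$ be the costs $c_{i1},\dots,c_{iK}$ in nonincreasing order, let $\hat c_i=\sum_{j=1}^Kw_j\hat c_{ij}$, and let $\hat X\in\Phi$ be a solution minimizing $\hat C(X)=\sum_{e_i\in X}\hat c_i$ over $X\in\Phi$. Then $$\mathrm{OWA}(\hat X)\le w_1K\cdot\mathrm{OWA}(X)\quad\text{for any }X\in\Phi,$$ and the bound is tight: for any number of scenarios $K$ and any nonincreasing weights $w_1,\dots,w_K$ there are an instance $(E,\Phi,\Gamma)$, a minimizer $\hat X$ of $\hat C$ over $\Phi$, and an $X\in\Phi$ such that $\mathrm{OWA}(X)>0$ and $\mathrm{OWA}(\hat X)=w_1K\cdot\mathrm{OWA}(X)$.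
   Context: $E=\{e_1,\dots,e_n\}$ is a finite set of elements, $\Phi\subseteq2^E$ is a (nonempty) set of feasible solutions, and $\Gamma=\{\pmb{c}_1,\dots,\pmb{c}_K\}$ is a scenario set of $K$ distinct cost scenarios $\pmb{c}_j=(c_{1j},\dots,c_{nj})$ with nonnegative entries. For $X\in\Phi$, $F(X,\pmb{c}_j)=\sum_{e_i\in X}c_{ij}$. For a weight vector $\pmb{w}=(w_1,\dots,w_K)$ with $w_j\in[0,1]$ and $\sum_jw_j=1$, $$\mathrm{OWA}(X)=\sum_{j=1}^Kw_jF(X,\pmb{c}_{\sigma(j)}),$$ where $\sigma$ is a permutation of $\{1,\dots,K\}$ with $F(X,\pmb{c}_{\sigma(1)})\ge\dots\ge F(X,\pmb{c}_{\sigma(K)})$. -}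

module Defs where

open import Algebra.Bundles using (CommutativeRing)
import Algebra.Definitions.RawMonoid as RawMonoidDefs
open import Data.Bool.Base using (if_then_else_)
open import Data.Fin.Base as Fin using (Fin; zero; suc; punchIn)
open import Data.Fin.Permutation using (Permutation′; _⟨$⟩ʳ_; id; insert; insert-punchIn)
open import Data.Fin.Subset using (Subset)
open import Data.Fin.Subset.Properties using (_∈?_)
open import Data.Nat.Base as ℕ using (ℕ; zero; suc; s≤s)
open import Data.Product.Base using (∃; _×_; _,_; proj₁; proj₂)
open import Data.Sum.Base using (inj₁; inj₂)
open import Data.Vec.Functional using (Vector)
import Data.Vec.Functional.Relation.Binary.Equality.Setoid as VectorEquality
open import Function.Base using (_∘_)
open import Function.Definitions using (Injective)
open import Level using (Level; _⊔_) renaming (suc to lsuc)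
open import Relation.Binary.Core using (Rel)
open import Relation.Binary.Definitions using (Antitonic₁)
open import Relation.Binary.PropositionalEquality.Core using (_≡_)
open import Relation.Binary.Structures using (IsTotalOrder)
import Relation.Binary.Construct.NonStrictToStrict as ToStrict
open import Relation.Nullary using (¬_; does)
open import Relation.Unary using (Pred; Satisfiable)

-- Costs and weights live in an arbitrary totally ordered field; ℚ is one, and
-- classically so is ℝ.

record OrderedField c ℓ₁ ℓ₂ : Set (lsuc (c ⊔ ℓ₁ ⊔ ℓ₂)) where
  infix 4 _≤_
  field
    commutativeRing : CommutativeRing c ℓ₁

  open CommutativeRing commutativeRing public renaming (zero to *-zero)

  field
    _≤_          : Rel Carrier ℓ₂
    isTotalOrder : IsTotalOrder _≈_ _≤_
    0≉1          : ¬ (0# ≈ 1#)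
    inverse      : ∀ x → ¬ (x ≈ 0#) → ∃ λ y → x * y ≈ 1#
    +-monoˡ-≤    : ∀ {x y} z → x ≤ y → x + z ≤ y + z
    *-nonneg     : ∀ {x y} → 0# ≤ x → 0# ≤ y → 0# ≤ x * y

  open ToStrict _≈_ _≤_ public using (_<_)
  open VectorEquality setoid public using (_≋_)
  open RawMonoidDefs +-rawMonoid public using (sum) renaming (_×_ to _×ₙ_)

  fromℕ : ℕ → Carrier
  fromℕ m = m ×ₙ 1#

module OWA-Optimization {c ℓ₁ ℓ₂ : Level} (𝔽 : OrderedField c ℓ₁ ℓ₂) where

  open OrderedField 𝔽
  private module ≤ = IsTotalOrder isTotalOrder

  Nonincreasing : ∀ {m} → Vector Carrier m → Set ℓ₂
  Nonincreasing = Antitonic₁ Fin._≤_ _≤_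

  argmax : ∀ {m} (f : Vector Carrier (suc m)) → ∃ λ i → ∀ j → f j ≤ f i
  argmax {zero} f = zero , λ { zero → ≤.refl }
  argmax {suc m} f with argmax (f ∘ suc)
  ... | i , max with ≤.total (f zero) (f (suc i))
  ...   | inj₁ f₀≤fᵢ = suc i , λ { zero → f₀≤fᵢ ; (suc j) → max j }
  ...   | inj₂ fᵢ≤f₀ = zero  , λ { zero → ≤.refl ; (suc j) → ≤.trans (max j) fᵢ≤f₀ }

  -- Selection sort. Sums and sorted vectors below depend on the permutation
  -- only through the sorted values, so the choice among ties is immaterial.

  sortingPermutation : ∀ {m} (f : Vector Carrier m) →
    ∃ λ (σ : Permutation′ m) → Nonincreasing (f ∘ (σ ⟨$⟩ʳ_))
  sortingPermutation {zero} f = id , λ { {()} }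
  sortingPermutation {suc m} f with argmax f
  ... | i , max with sortingPermutation (f ∘ punchIn i)
  ...   | τ , τ-sorts = insert zero i τ , sorts
    where
    sorts : Nonincreasing (f ∘ (insert zero i τ ⟨$⟩ʳ_))
    sorts {_}     {zero}  _ = max _
    sorts {suc x} {suc y} (s≤s y≤x)
      rewrite insert-punchIn zero i τ x | insert-punchIn zero i τ y = τ-sorts y≤x

  sort↓ : ∀ {m} → Vector Carrier m → Vector Carrier m
  sort↓ f = f ∘ (proj₁ (sortingPermutation f) ⟨$⟩ʳ_)

  Σ∈ : ∀ {n} → Subset n → Vector Carrier n → Carrier
  Σ∈ X a = sum λ i → if does (i ∈? X) then a i else 0#

  record IsWeightVector {K} (w : Vector Carrier K) : Set (ℓ₁ ⊔ ℓ₂) where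
    field
      nonneg : ∀ j → 0# ≤ w j
      ≤1     : ∀ j → w j ≤ 1#
      sum≈1  : sum w ≈ 1#

  -- The ground set is Fin n.

  record Instance (n K : ℕ) p : Set (c ⊔ ℓ₁ ⊔ ℓ₂ ⊔ lsuc p) where
    field
      Φ           : Pred (Subset n) p
      Φ-nonempty  : Satisfiable Φ
      cost        : Fin K → Vector Carrier n
      distinct    : Injective _≡_ _≋_ cost
      cost-nonneg : ∀ j i → 0# ≤ cost j i

  module _ {n K : ℕ} {p : Level} (I : Instance n K p) where
    open Instance I

    F : Subset n → Fin K → Carrier
    F X j = Σ∈ X (cost j)

    OWA : Vector Carrier K → Subset n → Carrier
    OWA w X = sum λ j → w j * sort↓ (F X) j

    ĉ : Vector Carrier K → Vector Carrier n
    ĉ w i = sum λ j → w j * sort↓ (λ k → cost k i) j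

    Ĉ : Vector Carrier K → Subset n → Carrier
    Ĉ w X = Σ∈ X (ĉ w)

    IsMinimizer : (Subset n → Carrier) → Subset n → Set (ℓ₂ ⊔ p)
    IsMinimizer C X = Φ X × (∀ Y → Φ Y → C X ≤ C Y)

{-# OPTIONS --safe #-}

-- The bound is the chain
--   OWA(X̂) ≤ Ĉ(X̂) ≤ Ĉ(X) ≤ w₁ Σⱼ F(X,cⱼ) ≤ w₁ K OWA(X).
-- The first step is the rearrangement inequality applied to each element, the
-- second is minimality, the third is wⱼ ≤ w₁, and the last is Chebyshev's sum
-- inequality with Σⱼ wⱼ = 1.
--
-- Tightness: one element costs K in the first scenario and 0 in the others, and
-- K further elements cost 1 each, every one in a scenario of its own. Both the
-- first element alone and the K others together have Ĉ = w₁ K; their OWA values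
-- are w₁ K and 1.

module Submission where

open import Defs
open import Data.Nat.Base using (ℕ; zero; suc; z≤n; s≤s)
open import Data.Bool.Base using (Bool; true; false; if_then_else_)
open import Data.Fin.Base using (Fin; zero; suc; punchIn)
open import Data.Fin.Permutation
  using (Permutation′; _⟨$⟩ʳ_; _⟨$⟩ˡ_; _∘ₚ_; flip; remove; punchIn-permute; inverseʳ)
open import Data.Fin.Properties using (_≟_)
open import Data.Fin.Subset using (Subset; inside; outside; ⊥; ⊤)
open import Data.Fin.Subset.Properties using (_∈?_; ∉⊥; ∈⊤)
open import Data.Product.Base using (_×_; Σ-syntax; ∃-syntax; _,_; proj₁; proj₂)
open import Data.Sum.Base using (_⊎_; inj₁; inj₂)
open import Data.Vec.Base using (_∷_)
open import Data.Vec.Functional using (Vector; head; tail)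
open import Function.Base using (_∘_)
open import Level using (Level; Lift; lift)
open import Relation.Binary.Bundles using (TotalOrder)
open import Relation.Binary.PropositionalEquality as ≡ using (_≡_; _≢_)
open import Relation.Binary.Structures using (IsTotalOrder)
open import Relation.Nullary using (does; yes; no; contradiction)
open import Relation.Nullary.Decidable using (dec-true; dec-false)
import Algebra.Properties.Ring as RingProperties
import Algebra.Properties.Semiring.Mult as SemiringMult
import Algebra.Properties.Semiring.Sum as SemiringSum
import Algebra.Solver.Ring.NaturalCoefficients.Default as SemiringSolver
import Relation.Binary.Reasoning.PartialOrder as PartialOrderReasoning

module OrderedFieldProperties {c ℓ₁ ℓ₂ : Level} (𝔽 : OrderedField c ℓ₁ ℓ₂) where

  open OrderedField 𝔽
  open OWA-Optimization 𝔽 using (Nonincreasing; sortingPermutation; sort↓)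
  open SemiringSum semiring
    using (sum-cong-≋; sum-replicate; sum-replicate-zero; ∑-distrib-+; sum-permute;
           *-distribˡ-sum; *-distribʳ-sum)
  open SemiringMult semiring using (×-congʳ; ×-assoc-*)
  open RingProperties ring using (-‿distribʳ-*; -‿involutive)
  open SemiringSolver commutativeSemiring using (solve; _:+_; _:*_; _:=_)

  totalOrder : TotalOrder c ℓ₁ ℓ₂
  totalOrder = record { isTotalOrder = isTotalOrder }

  module ≤ = IsTotalOrder isTotalOrder
  module ≤-Reasoning = PartialOrderReasoning (TotalOrder.poset totalOrder)
  open ≤-Reasoning

  infixl 8 _·_

  _·_ : ∀ {m} → Vector Carrier m → Vector Carrier m → Carrier
  a · b = sum λ j → a j * b j

  -- Arithmetic in an ordered field.

  +-monoʳ-≤ : ∀ {x y} z → x ≤ y → z + x ≤ z + y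
  +-monoʳ-≤ {x} {y} z x≤y = begin
    z + x  ≈⟨ +-comm z x ⟩
    x + z  ≤⟨ +-monoˡ-≤ z x≤y ⟩
    y + z  ≈⟨ +-comm y z ⟩
    z + y  ∎

  +-mono-≤ : ∀ {x y u v} → x ≤ y → u ≤ v → x + u ≤ y + v
  +-mono-≤ {y = y} {u = u} x≤y u≤v = ≤.trans (+-monoˡ-≤ u x≤y) (+-monoʳ-≤ y u≤v)

  x≤x+y : ∀ x {y} → 0# ≤ y → x ≤ x + y
  x≤x+y x {y} 0≤y = begin
    x       ≈⟨ +-identityʳ x ⟨
    x + 0#  ≤⟨ +-monoʳ-≤ x 0≤y ⟩
    x + y   ∎

  -- Replaces an inequality by an equation with a nonnegative gap, so that inequalities between
  -- products reduce to semiring identities free of subtraction.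
  ≤⇒+ : ∀ {x y} → x ≤ y → ∃[ d ] (0# ≤ d × y ≈ x + d)
  ≤⇒+ {x} {y} x≤y = y - x , 0≤y-x , y≈x+[y-x]
    where
    0≤y-x : 0# ≤ y - x
    0≤y-x = begin
      0#     ≈⟨ -‿inverseʳ x ⟨
      x - x  ≤⟨ +-monoˡ-≤ (- x) x≤y ⟩
      y - x  ∎
    y≈x+[y-x] : y ≈ x + (y - x)
    y≈x+[y-x] = begin-equality
      y              ≈⟨ +-identityʳ y ⟨
      y + 0#         ≈⟨ +-congˡ (-‿inverseˡ x) ⟨
      y + (- x + x)  ≈⟨ +-assoc y (- x) x ⟨
      (y - x) + x    ≈⟨ +-comm (y - x) x ⟩
      x + (y - x)    ∎

  *-monoˡ-≤ : ∀ {x y z} → 0# ≤ z → x ≤ y → z * x ≤ z * y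
  *-monoˡ-≤ {x} {y} {z} 0≤z x≤y with ≤⇒+ x≤y
  ... | d , 0≤d , y≈x+d = begin
    z * x          ≤⟨ x≤x+y (z * x) (*-nonneg 0≤z 0≤d) ⟩
    z * x + z * d  ≈⟨ distribˡ z x d ⟨
    z * (x + d)    ≈⟨ *-congˡ y≈x+d ⟨
    z * y          ∎

  *-monoʳ-≤ : ∀ {x y z} → 0# ≤ z → x ≤ y → x * z ≤ y * z
  *-monoʳ-≤ {x} {y} {z} 0≤z x≤y = begin
    x * z  ≈⟨ *-comm x z ⟩
    z * x  ≤⟨ *-monoˡ-≤ 0≤z x≤y ⟩
    z * y  ≈⟨ *-comm z y ⟩
    y * z  ∎

  -- The two sides differ by `(a - b) * (x - y)`, which is `d * e` in terms of the gaps. This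
  -- exchange step drives both the rearrangement and the Chebyshev inequality.
  *-rearrange₂ : ∀ {a b x y} → b ≤ a → y ≤ x → a * y + b * x ≤ a * x + b * y
  *-rearrange₂ {a} {b} {x} {y} b≤a y≤x with ≤⇒+ b≤a | ≤⇒+ y≤x
  ... | d , 0≤d , a≈b+d | e , 0≤e , x≈y+e = begin
    a * y + b * x                    ≈⟨ +-cong (*-congʳ a≈b+d) (*-congˡ x≈y+e) ⟩
    (b + d) * y + b * (y + e)        ≤⟨ x≤x+y _ (*-nonneg 0≤d 0≤e) ⟩
    (b + d) * y + b * (y + e) + d * e
      ≈⟨ solve 4 (λ b d y e → (b :+ d) :* y :+ b :* (y :+ e) :+ d :* e
                           := (b :+ d) :* (y :+ e) :+ b :* y) refl b d y e ⟩
    (b + d) * (y + e) + b * y        ≈⟨ +-congʳ (*-cong a≈b+d x≈y+e) ⟨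
    a * x + b * y                    ∎

  -- By totality the only other case is `1# ≤ 0#`; then `- 1#` is nonnegative, hence so is its
  -- square, which is `1#`.
  0≤1 : 0# ≤ 1#
  0≤1 with ≤.total 0# 1#
  ... | inj₁ 0≤1 = 0≤1
  ... | inj₂ 1≤0 = begin
    0#             ≤⟨ *-nonneg 0≤-1 0≤-1 ⟩
    - 1# * - 1#    ≈⟨ -‿distribʳ-* (- 1#) 1# ⟨
    - (- 1# * 1#)  ≈⟨ -‿cong (*-identityʳ (- 1#)) ⟩
    - - 1#         ≈⟨ -‿involutive 1# ⟩
    1#             ∎
    where
    0≤-1 : 0# ≤ - 1#
    0≤-1 = begin
      0#         ≈⟨ -‿inverseʳ 1# ⟨
      1# - 1#    ≤⟨ +-monoˡ-≤ (- 1#) 1≤0 ⟩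
      0# - 1#    ≈⟨ +-identityˡ (- 1#) ⟩
      - 1#       ∎

  -- Inequalities between finite sums.

  sum-mono-≤ : ∀ {m} {f g : Vector Carrier m} → (∀ j → f j ≤ g j) → sum f ≤ sum g
  sum-mono-≤ {zero}  f≤g = ≤.refl
  sum-mono-≤ {suc m} f≤g = +-mono-≤ (f≤g zero) (sum-mono-≤ (f≤g ∘ suc))

  sum-nonneg : ∀ {m} {f : Vector Carrier m} → (∀ j → 0# ≤ f j) → 0# ≤ sum f
  sum-nonneg {m} {f} 0≤f = begin
    0#                   ≈⟨ sum-replicate-zero m ⟨
    sum {m} (λ _ → 0#)   ≤⟨ sum-mono-≤ 0≤f ⟩
    sum f                ∎

  0≤fromℕ : ∀ m → 0# ≤ fromℕ m
  0≤fromℕ zero    = ≤.refl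
  0≤fromℕ (suc m) = ≤.trans 0≤1 (x≤x+y 1# (0≤fromℕ m))

  ×ₙ≈fromℕ* : ∀ m x → m ×ₙ x ≈ fromℕ m * x
  ×ₙ≈fromℕ* m x = trans (×-congʳ m (sym (*-identityˡ x))) (sym (×-assoc-* m 1# x))

  -- Sorted vectors, rearrangement and Chebyshev's inequality.

  tail-nonincreasing : ∀ {m} {w : Vector Carrier (suc m)} → Nonincreasing w →
                       Nonincreasing (tail w)
  tail-nonincreasing w↓ {x} {y} y≤x = w↓ {suc x} {suc y} (s≤s y≤x)

  head-max : ∀ {m} {w : Vector Carrier (suc m)} → Nonincreasing w → ∀ j → w j ≤ w zero
  head-max w↓ j = w↓ {j} {zero} z≤n

  sum-sort↓ : ∀ {m} (f : Vector Carrier m) → sum (sort↓ f) ≈ sum f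
  sum-sort↓ f = sym (sum-permute f (proj₁ (sortingPermutation f)))

  ≤-head-sort↓ : ∀ {m} (f : Vector Carrier (suc m)) j → f j ≤ sort↓ f zero
  ≤-head-sort↓ f j = begin
    f j                      ≡⟨ ≡.cong f (inverseʳ σ) ⟨
    sort↓ f (σ ⟨$⟩ˡ j)       ≤⟨ head-max (proj₂ (sortingPermutation f)) (σ ⟨$⟩ˡ j) ⟩
    sort↓ f zero             ∎
    where
    σ = proj₁ (sortingPermutation f)

  -- One pass of bubble sort: the recursive call carries the maximum to the head of the tail, and
  -- one adjacent exchange carries it to the front. The other entries keep their order.
  ·-max-to-front : ∀ {m} {w : Vector Carrier (suc m)} → Nonincreasing w →
    ∀ f i → (∀ j → f j ≤ f i) →
    w · f ≤ w zero * f i + tail w · (f ∘ punchIn i)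
  ·-max-to-front w↓ f zero f≤fᵢ = ≤.refl
  ·-max-to-front {suc m} {w} w↓ f (suc i) f≤fᵢ = begin
    w zero * f zero + tail w · tail f
      ≤⟨ +-monoʳ-≤ _ (·-max-to-front (tail-nonincreasing w↓) (tail f) i (f≤fᵢ ∘ suc)) ⟩
    w zero * f zero + (w (suc zero) * f (suc i) + R)
      ≈⟨ +-assoc _ _ _ ⟨
    w zero * f zero + w (suc zero) * f (suc i) + R
      ≤⟨ +-monoˡ-≤ R (*-rearrange₂ (head-max w↓ (suc zero)) (f≤fᵢ zero)) ⟩
    w zero * f (suc i) + w (suc zero) * f zero + R
      ≈⟨ +-assoc _ _ _ ⟩
    -- `punchIn (suc i)` fixes `zero`, so the bracket is `tail w · (f ∘ punchIn (suc i))` by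
    -- computation.
    w zero * f (suc i) + (w (suc zero) * f zero + R)  ∎
    where
    R = tail (tail w) · (tail f ∘ punchIn i)

  -- Induction along selection sort: the head of `g` is a maximum of `f`, so it can be brought to
  -- the front, after which the tails are compared. The relation of `g` to `f` is a pointwise
  -- equation because, once an index is removed from `π`, the tail of `g` is a permutation of the
  -- rest of `f` only propositionally.
  rearrangement : ∀ {m} {w : Vector Carrier m} → Nonincreasing w →
    ∀ f g (π : Permutation′ m) → (∀ j → g j ≡ f (π ⟨$⟩ʳ j)) → Nonincreasing g →
    w · f ≤ w · g
  rearrangement {zero} w↓ f g π g≡fπ g↓ = ≤.refl
  rearrangement {suc m} {w} w↓ f g π g≡fπ g↓ = begin
    w · f                                       ≤⟨ ·-max-to-front w↓ f i f≤fᵢ ⟩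
    w zero * f i + tail w · (f ∘ punchIn i)
      ≤⟨ +-monoʳ-≤ _ (rearrangement (tail-nonincreasing w↓) (f ∘ punchIn i) (tail g)
           (remove zero π) g≡fπ′ (tail-nonincreasing g↓)) ⟩
    w zero * f i + tail w · tail g              ≡⟨ ≡.cong (λ x → w zero * x + tail w · tail g) (g≡fπ zero) ⟨
    w zero * g zero + tail w · tail g           ∎
    where
    i = π ⟨$⟩ʳ zero
    f≤fᵢ : ∀ j → f j ≤ f i
    f≤fᵢ j = begin
      f j                    ≡⟨ ≡.cong f (inverseʳ π) ⟨
      f (π ⟨$⟩ʳ (π ⟨$⟩ˡ j))  ≡⟨ g≡fπ (π ⟨$⟩ˡ j) ⟨
      g (π ⟨$⟩ˡ j)           ≤⟨ head-max g↓ (π ⟨$⟩ˡ j) ⟩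
      g zero                 ≡⟨ g≡fπ zero ⟩
      f i                    ∎
    g≡fπ′ : ∀ j → g (suc j) ≡ f (punchIn i (remove zero π ⟨$⟩ʳ j))
    g≡fπ′ j = ≡.trans (g≡fπ (suc j)) (≡.cong f (punchIn-permute π zero j))

  ·-permute≤·-sort↓ : ∀ {m} {w : Vector Carrier m} → Nonincreasing w →
    ∀ f (σ : Permutation′ m) → w · (f ∘ (σ ⟨$⟩ʳ_)) ≤ w · sort↓ f
  ·-permute≤·-sort↓ w↓ f σ =
    -- `_∘ₚ_` applies its left argument first: an index is sent to its source under sorting, and
    -- `flip σ` then cancels the `σ` inside the permuted vector.
    rearrangement w↓ (f ∘ (σ ⟨$⟩ʳ_)) (sort↓ f) (proj₁ (sortingPermutation f) ∘ₚ flip σ)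
      (λ j → ≡.cong f (≡.sym (inverseʳ σ))) (proj₂ (sortingPermutation f))

  -- Split off both heads. By the exchange inequality each pair of cross terms is at most a product
  -- of heads plus a product of equal-index entries, so the `m` pairs contribute `m` copies of
  -- `w₀ * f₀` and one of `P`; the induction hypothesis contributes `m` more copies of `P`.
  chebyshev : ∀ {m} {w f : Vector Carrier m} → Nonincreasing w → Nonincreasing f →
              sum w * sum f ≤ fromℕ m * (w · f)
  chebyshev {zero} w↓ f↓ = ≤.reflexive (trans (zeroˡ 0#) (sym (zeroˡ 0#)))
  chebyshev {suc m} {w} {f} w↓ f↓ = begin
    (w₀ + W) * (f₀ + S)
      ≈⟨ solve 4 (λ w₀ W f₀ S → (w₀ :+ W) :* (f₀ :+ S)
                             := w₀ :* f₀ :+ (w₀ :* S :+ W :* f₀) :+ W :* S) refl w₀ W f₀ S ⟩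
    w₀ * f₀ + (w₀ * S + W * f₀) + W * S
      ≤⟨ +-mono-≤ (+-monoʳ-≤ (w₀ * f₀) cross)
                  (chebyshev (tail-nonincreasing w↓) (tail-nonincreasing f↓)) ⟩
    w₀ * f₀ + (fromℕ m * (w₀ * f₀) + P) + fromℕ m * P
      ≈⟨ solve 3 (λ a n P → a :+ (n :* a :+ P) :+ n :* P
                         := (a :+ P) :+ n :* (a :+ P)) refl (w₀ * f₀) (fromℕ m) P ⟩
    (w₀ * f₀ + P) + fromℕ m * (w₀ * f₀ + P)
      ≈⟨ +-congʳ (*-identityˡ (w₀ * f₀ + P)) ⟨
    1# * (w₀ * f₀ + P) + fromℕ m * (w₀ * f₀ + P)
      ≈⟨ distribʳ (w₀ * f₀ + P) 1# (fromℕ m) ⟨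
    (1# + fromℕ m) * (w₀ * f₀ + P)  ∎
    where
    w₀ = head w
    f₀ = head f
    W = sum (tail w)
    S = sum (tail f)
    P = tail w · tail f
    cross : w₀ * S + W * f₀ ≤ fromℕ m * (w₀ * f₀) + P
    cross = begin
      w₀ * S + W * f₀
        ≈⟨ +-cong (*-distribˡ-sum w₀ (tail f)) (*-distribʳ-sum f₀ (tail w)) ⟩
      sum (λ j → w₀ * f (suc j)) + sum (λ j → w (suc j) * f₀)
        ≈⟨ ∑-distrib-+ (λ j → w₀ * f (suc j)) (λ j → w (suc j) * f₀) ⟨
      sum (λ j → w₀ * f (suc j) + w (suc j) * f₀)
        ≤⟨ sum-mono-≤ (λ j → *-rearrange₂ (head-max w↓ (suc j)) (head-max f↓ (suc j))) ⟩
      sum (λ j → w₀ * f₀ + w (suc j) * f (suc j))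
        ≈⟨ ∑-distrib-+ (λ _ → w₀ * f₀) (λ j → w (suc j) * f (suc j)) ⟩
      sum {m} (λ _ → w₀ * f₀) + P
        ≈⟨ +-congʳ (trans (sum-replicate m) (×ₙ≈fromℕ* m (w₀ * f₀))) ⟩
      fromℕ m * (w₀ * f₀) + P  ∎

  -- Weighted sums of a sorted vector against its plain sum.

  sort↓-nonneg : ∀ {m} {f : Vector Carrier m} → (∀ j → 0# ≤ f j) → ∀ j → 0# ≤ sort↓ f j
  sort↓-nonneg {f = f} 0≤f j = 0≤f (proj₁ (sortingPermutation f) ⟨$⟩ʳ j)

  -- Each weight is raised to the largest one, which is harmless since the entries are nonnegative;
  -- with a constant weight the order no longer matters.
  ·-sort↓≤head*sum : ∀ {m} {w : Vector Carrier (suc m)} → Nonincreasing w →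
    ∀ {f} → (∀ j → 0# ≤ f j) → w · sort↓ f ≤ w zero * sum f
  ·-sort↓≤head*sum {w = w} w↓ {f} 0≤f = begin
    w · sort↓ f                       ≤⟨ sum-mono-≤ (λ j → *-monoʳ-≤ (sort↓-nonneg 0≤f j) (head-max w↓ j)) ⟩
    sum (λ j → w zero * sort↓ f j)    ≈⟨ *-distribˡ-sum (w zero) (sort↓ f) ⟨
    w zero * sum (sort↓ f)            ≈⟨ *-congˡ (sum-sort↓ f) ⟩
    w zero * sum f                    ∎

  -- With total weight one, Chebyshev says that the ordered weighted average is at least the
  -- arithmetic mean.
  sum≤fromℕ*·-sort↓ : ∀ {m} {w : Vector Carrier m} → Nonincreasing w → sum w ≈ 1# →
    ∀ f → sum f ≤ fromℕ m * (w · sort↓ f)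
  sum≤fromℕ*·-sort↓ {m} {w} w↓ Σw≈1 f = begin
    sum f                    ≈⟨ sum-sort↓ f ⟨
    sum (sort↓ f)            ≈⟨ *-identityˡ _ ⟨
    1# * sum (sort↓ f)       ≈⟨ *-congʳ Σw≈1 ⟨
    sum w * sum (sort↓ f)    ≤⟨ chebyshev w↓ (proj₂ (sortingPermutation f)) ⟩
    fromℕ m * (w · sort↓ f)  ∎

  -- Nonnegative f with total f i vanishes off i, so sorting puts f i first.
  ·-sort↓-concentrated : ∀ {m} {w : Vector Carrier (suc m)} → (∀ j → 0# ≤ w j) →
    Nonincreasing w → ∀ {f} → (∀ j → 0# ≤ f j) → ∀ i {x} → f i ≈ x → sum f ≈ x →
    w · sort↓ f ≈ w zero * x
  ·-sort↓-concentrated {w = w} 0≤w w↓ {f} 0≤f i {x} fᵢ≈x Σf≈x = ≤.antisym upper lower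
    where
    upper : w · sort↓ f ≤ w zero * x
    upper = begin
      w · sort↓ f     ≤⟨ ·-sort↓≤head*sum w↓ 0≤f ⟩
      w zero * sum f  ≈⟨ *-congˡ Σf≈x ⟩
      w zero * x      ∎
    lower : w zero * x ≤ w · sort↓ f
    lower = begin
      w zero * x               ≈⟨ *-congˡ fᵢ≈x ⟨
      w zero * f i             ≤⟨ *-monoˡ-≤ (0≤w zero) (≤-head-sort↓ f i) ⟩
      w zero * sort↓ f zero    ≤⟨ x≤x+y _ (sum-nonneg (λ j → *-nonneg (0≤w (suc j)) (sort↓-nonneg 0≤f (suc j)))) ⟩
      w · sort↓ f              ∎

  -- Scalar multiples of unit vectors.

  single : ∀ {m} → Fin m → Carrier → Vector Carrier m
  single i x j = if does (j ≟ i) then x else 0#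

  single-diagonal : ∀ {m} (i : Fin m) x → single i x i ≡ x
  single-diagonal i x = ≡.cong (if_then x else 0#) (dec-true (i ≟ i) ≡.refl)

  single-off-diagonal : ∀ {m} {i j : Fin m} x → j ≢ i → single i x j ≡ 0#
  single-off-diagonal {i = i} {j} x j≢i = ≡.cong (if_then x else 0#) (dec-false (j ≟ i) j≢i)

  single-comm : ∀ {m} (i j : Fin m) x → single i x j ≡ single j x i
  single-comm zero    zero    x = ≡.refl
  single-comm zero    (suc j) x = ≡.refl
  single-comm (suc i) zero    x = ≡.refl
  single-comm (suc i) (suc j) x = single-comm i j x

  single-nonneg : ∀ {m} (i : Fin m) {x} → 0# ≤ x → ∀ j → 0# ≤ single i x j
  single-nonneg i 0≤x j with does (j ≟ i)
  ... | true  = 0≤x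
  ... | false = ≤.refl

  sum-single : ∀ {m} (i : Fin m) x → sum (single i x) ≈ x
  sum-single {suc m} zero    x = trans (+-congˡ (sum-replicate-zero m)) (+-identityʳ x)
  sum-single         (suc i) x = trans (+-identityˡ _) (sum-single i x)

module OWAProperties {c ℓ₁ ℓ₂ : Level} (𝔽 : OrderedField c ℓ₁ ℓ₂) where

  open OrderedField 𝔽
  open OWA-Optimization 𝔽
  open OrderedFieldProperties 𝔽
  open ≤-Reasoning
  open SemiringSum semiring
    using (sum-cong-≋; sum-replicate; sum-replicate-zero; ∑-comm; *-distribˡ-sum)

  -- Sums over a subset of the elements.

  Σ∈-mono-≤ : ∀ {n} (X : Subset n) {a b : Vector Carrier n} → (∀ i → a i ≤ b i) →
              Σ∈ X a ≤ Σ∈ X b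
  Σ∈-mono-≤ X {a} {b} a≤b = sum-mono-≤ λ i → lemma i (does (i ∈? X))
    where
    lemma : ∀ i (s : Bool) → (if s then a i else 0#) ≤ (if s then b i else 0#)
    lemma i true  = a≤b i
    lemma i false = ≤.refl

  Σ∈-nonneg : ∀ {n} (X : Subset n) {a : Vector Carrier n} → (∀ i → 0# ≤ a i) → 0# ≤ Σ∈ X a
  Σ∈-nonneg X {a} 0≤a = sum-nonneg λ i → lemma i (does (i ∈? X))
    where
    lemma : ∀ i (s : Bool) → 0# ≤ (if s then a i else 0#)
    lemma i true  = 0≤a i
    lemma i false = ≤.refl

  -- Interchanges the sums over scenarios and elements. For a fixed order of the scenarios, this
  -- lets solution costs be compared with `Ĉ` element by element.
  Σ∈-linear : ∀ {n m} (X : Subset n) (w : Vector Carrier m) (a : Fin m → Vector Carrier n) →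
              w · (λ j → Σ∈ X (a j)) ≈ Σ∈ X (λ i → w · (λ j → a j i))
  Σ∈-linear {m = m} X w a = begin-equality
    sum (λ j → w j * sum (λ i → term i (a j i)))
      ≈⟨ sum-cong-≋ (λ j → *-distribˡ-sum (w j) (λ i → term i (a j i))) ⟩
    sum (λ j → sum (λ i → w j * term i (a j i)))
      ≈⟨ ∑-comm (λ j i → w j * term i (a j i)) ⟩
    sum (λ i → sum (λ j → w j * term i (a j i)))
      ≈⟨ sum-cong-≋ (λ i → pull i (does (i ∈? X))) ⟩
    Σ∈ X (λ i → w · (λ j → a j i))  ∎
    where
    term = λ i x → if does (i ∈? X) then x else 0#
    -- Membership of `i` does not depend on the scenario, so one Boolean `s` stands for the test in
    -- every term and a single case split settles them all.
    pull : ∀ i (s : Bool) → sum (λ j → w j * (if s then a j i else 0#))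
                          ≈ (if s then w · (λ j → a j i) else 0#)
    pull i true  = refl
    pull i false = trans (sum-cong-≋ (λ j → zeroʳ (w j))) (sum-replicate-zero m)

  Σ∈-⊥ : ∀ {n} (a : Vector Carrier n) → Σ∈ ⊥ a ≈ 0#
  Σ∈-⊥ {n} a = trans
    (sum-cong-≋ λ i → reflexive (≡.cong (if_then a i else 0#) (dec-false (i ∈? ⊥) ∉⊥)))
    (sum-replicate-zero n)

  Σ∈-⊤ : ∀ {n} (a : Vector Carrier n) → Σ∈ ⊤ a ≈ sum a
  Σ∈-⊤ a = sum-cong-≋ λ i → reflexive (≡.cong (if_then a i else 0#) (dec-true (i ∈? ⊤) ∈⊤))

  -- The approximation bound.

  module _ {n k : ℕ} {p : Level} (I : Instance n (suc k) p)
           {w : Vector Carrier (suc k)} (w-weights : IsWeightVector w) (w↓ : Nonincreasing w)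
           where

    open Instance I
    open IsWeightVector w-weights

    -- `OWA` puts the scenarios in one order `σ` common to all elements, whereas `Ĉ` sorts the costs
    -- of each element separately, which can only increase its contribution.
    OWA≤Ĉ : ∀ X → OWA I w X ≤ Ĉ I w X
    OWA≤Ĉ X = begin
      w · (λ j → Σ∈ X (cost (σ ⟨$⟩ʳ j)))             ≈⟨ Σ∈-linear X w (λ j → cost (σ ⟨$⟩ʳ j)) ⟩
      Σ∈ X (λ i → w · (λ j → cost (σ ⟨$⟩ʳ j) i))
        ≤⟨ Σ∈-mono-≤ X (λ i → ·-permute≤·-sort↓ w↓ (λ j → cost j i) σ) ⟩
      Ĉ I w X                                        ∎
      where
      σ = proj₁ (sortingPermutation (F I X))

    -- Raising the weights to `w zero` frees the element costs from their separate orders. What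
    -- remains is a plain double sum, which is regrouped by scenario and compared with `OWA` through
    -- Chebyshev.
    Ĉ≤head*fromℕ*OWA : ∀ X → Ĉ I w X ≤ (w zero * fromℕ (suc k)) * OWA I w X
    Ĉ≤head*fromℕ*OWA X = begin
      Ĉ I w X
        ≤⟨ Σ∈-mono-≤ X (λ i → ·-sort↓≤head*sum w↓ (λ j → cost-nonneg j i)) ⟩
      Σ∈ X (λ i → w zero * sum (λ j → cost j i))
        ≈⟨ sum-cong-≋ (λ i → if-cong (does (i ∈? X)) (*-distribˡ-sum (w zero) (λ j → cost j i))) ⟩
      Σ∈ X (λ i → (λ _ → w zero) · (λ j → cost j i))
        ≈⟨ Σ∈-linear X (λ _ → w zero) cost ⟨
      (λ _ → w zero) · F I X
        ≈⟨ *-distribˡ-sum (w zero) (F I X) ⟨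
      w zero * sum (F I X)
        ≤⟨ *-monoˡ-≤ (nonneg zero) (sum≤fromℕ*·-sort↓ w↓ sum≈1 (F I X)) ⟩
      w zero * (fromℕ (suc k) * OWA I w X)
        ≈⟨ *-assoc (w zero) (fromℕ (suc k)) (OWA I w X) ⟨
      (w zero * fromℕ (suc k)) * OWA I w X  ∎
      where
      if-cong : ∀ (s : Bool) {x y} → x ≈ y → (if s then x else 0#) ≈ (if s then y else 0#)
      if-cong true  x≈y = x≈y
      if-cong false x≈y = refl

    -- Weights summing to `1#` cannot form an empty vector; writing the number of scenarios as
    -- `suc k` makes the largest weight available as `w zero`.
    OWA-minimizer-bound : ∀ {X̂} → IsMinimizer I (Ĉ I w) X̂ →
      ∀ X → Φ X → OWA I w X̂ ≤ (w zero * fromℕ (suc k)) * OWA I w X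
    OWA-minimizer-bound {X̂} (_ , X̂-min) X X∈Φ = begin
      OWA I w X̂                               ≤⟨ OWA≤Ĉ X̂ ⟩
      Ĉ I w X̂                                 ≤⟨ X̂-min X X∈Φ ⟩
      Ĉ I w X                                 ≤⟨ Ĉ≤head*fromℕ*OWA X ⟩
      (w zero * fromℕ (suc k)) * OWA I w X    ∎

  -- The tight instance.

  module Tightness (k : ℕ) (p : Level) where

    K : ℕ
    K = suc k

    X̂ X : Subset (suc K)
    X̂ = inside ∷ ⊥
    X = outside ∷ ⊤

    tightCost : Fin K → Vector Carrier (suc K)
    tightCost j zero    = single zero (fromℕ K) j
    tightCost j (suc i) = single i 1# j

    tightCost-nonneg : ∀ j i → 0# ≤ tightCost j i
    tightCost-nonneg j zero    = single-nonneg zero (0≤fromℕ K) j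
    tightCost-nonneg j (suc i) = single-nonneg i 0≤1 j

    -- Among all scenarios only `j` charges for the element `suc j`, so a different scenario with
    -- the same costs would give `0# ≈ 1#`.
    tightCost-distinct : ∀ {j j′} → tightCost j ≋ tightCost j′ → j ≡ j′
    tightCost-distinct {j} {j′} eq with j ≟ j′
    ... | yes j≡j′ = j≡j′
    ... | no  j≢j′ = contradiction 0≈1 0≉1
      where
      0≈1 : 0# ≈ 1#
      0≈1 = begin-equality
        0#             ≡⟨ single-off-diagonal 1# (j≢j′ ∘ ≡.sym) ⟨
        single j 1# j′ ≈⟨ eq (suc j) ⟨
        single j 1# j  ≡⟨ single-diagonal j 1# ⟩
        1#             ∎

    tight : Instance (suc K) K p
    tight = record
      -- With only two feasible solutions, minimality comes down to one comparison. `Lift` moves the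
      -- family to the prescribed level `p`.
      { Φ           = λ Y → Lift p (Y ≡ X̂ ⊎ Y ≡ X)
      ; Φ-nonempty  = X̂ , lift (inj₁ ≡.refl)
      ; cost        = tightCost
      ; distinct    = tightCost-distinct
      ; cost-nonneg = tightCost-nonneg
      }

    open Instance tight

    X∈Φ : Φ X
    X∈Φ = lift (inj₂ ≡.refl)

    F-X̂ : ∀ j → F tight X̂ j ≈ single zero (fromℕ K) j
    F-X̂ j = trans (+-congˡ (Σ∈-⊥ (tail (tightCost j)))) (+-identityʳ _)

    F-X : ∀ j → F tight X j ≈ 1#
    F-X j = begin-equality
      0# + Σ∈ ⊤ (tail (tightCost j))  ≈⟨ +-identityˡ _ ⟩
      Σ∈ ⊤ (tail (tightCost j))       ≈⟨ Σ∈-⊤ (tail (tightCost j)) ⟩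
      -- The sum runs over elements with the scenario fixed; by symmetry of the identity matrix it
      -- becomes the sum of a unit vector.
      sum (λ i → single i 1# j)       ≈⟨ sum-cong-≋ (λ i → reflexive (single-comm i j 1#)) ⟩
      sum (single j 1#)               ≈⟨ sum-single j 1# ⟩
      1#                              ∎

    module _ {w : Vector Carrier K} (w-weights : IsWeightVector w) (w↓ : Nonincreasing w) where

      open IsWeightVector w-weights

      -- Each element of the instance is charged in a single scenario, so this evaluates every `ĉ`.
      ·-sort↓-single : ∀ i {x} → 0# ≤ x → w · sort↓ (single i x) ≈ w zero * x
      ·-sort↓-single i {x} 0≤x = ·-sort↓-concentrated nonneg w↓ (single-nonneg i 0≤x) i
        (reflexive (single-diagonal i x)) (sum-single i x)

      Ĉ-X̂ : Ĉ tight w X̂ ≈ w zero * fromℕ K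
      Ĉ-X̂ = begin-equality
        ĉ tight w zero + Σ∈ ⊥ (tail (ĉ tight w))  ≈⟨ +-congˡ (Σ∈-⊥ (tail (ĉ tight w))) ⟩
        ĉ tight w zero + 0#                       ≈⟨ +-identityʳ _ ⟩
        ĉ tight w zero                            ≈⟨ ·-sort↓-single zero (0≤fromℕ K) ⟩
        w zero * fromℕ K                          ∎

      Ĉ-X : Ĉ tight w X ≈ w zero * fromℕ K
      Ĉ-X = begin-equality
        0# + Σ∈ ⊤ (tail (ĉ tight w))  ≈⟨ +-identityˡ _ ⟩
        Σ∈ ⊤ (tail (ĉ tight w))       ≈⟨ Σ∈-⊤ (tail (ĉ tight w)) ⟩
        sum (tail (ĉ tight w))        ≈⟨ sum-cong-≋ (λ i → ·-sort↓-single i 0≤1) ⟩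
        sum {K} (λ _ → w zero * 1#)   ≈⟨ *-distribˡ-sum {K} (w zero) (λ _ → 1#) ⟨
        w zero * sum {K} (λ _ → 1#)   ≈⟨ *-congˡ (sum-replicate K) ⟩
        w zero * fromℕ K              ∎

      OWA-X̂ : OWA tight w X̂ ≈ w zero * fromℕ K
      -- `F tight X̂` matches a `single` vector only up to `≈`, while `sort↓` picks its permutation
      -- from the vector itself. The concentrated form needs only one entry and the total, and both
      -- transfer along `≈`.
      OWA-X̂ = ·-sort↓-concentrated nonneg w↓ (λ j → Σ∈-nonneg X̂ (tightCost-nonneg j)) zero
        (F-X̂ zero) (trans (sum-cong-≋ {K} {F tight X̂} F-X̂) (sum-single {K} zero (fromℕ K)))

      OWA-X : OWA tight w X ≈ 1#
      OWA-X = begin-equality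
        -- Every scenario cost is one, so the sorting order is immaterial.
        w · sort↓ (F tight X)    ≈⟨ sum-cong-≋ {K} (λ j → *-congˡ {w j} (F-X (σ ⟨$⟩ʳ j))) ⟩
        sum (λ j → w j * 1#)     ≈⟨ sum-cong-≋ (λ j → *-identityʳ (w j)) ⟩
        sum w                    ≈⟨ sum≈1 ⟩
        1#                       ∎
        where
        σ = proj₁ (sortingPermutation (F tight X))

      X̂-minimizer : IsMinimizer tight (Ĉ tight w) X̂
      X̂-minimizer = lift (inj₁ ≡.refl) , λ where
        _ (lift (inj₁ ≡.refl)) → ≤.refl
        -- The two solutions tie for `Ĉ`, so the worse one for `OWA` is a legitimate minimizer.
        _ (lift (inj₂ ≡.refl)) → ≤.reflexive (trans Ĉ-X̂ (sym Ĉ-X))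

      0<OWA-X : 0# < OWA tight w X
      -- `_<_` is `_≤_` together with inequality of the two sides, hence the pair.
      0<OWA-X = ≤.trans 0≤1 (≤.reflexive (sym OWA-X)) , λ 0≈OWA → 0≉1 (trans 0≈OWA OWA-X)

      OWA-tight : OWA tight w X̂ ≈ (w zero * fromℕ K) * OWA tight w X
      OWA-tight = begin-equality
        OWA tight w X̂                        ≈⟨ OWA-X̂ ⟩
        w zero * fromℕ K                     ≈⟨ *-identityʳ _ ⟨
        (w zero * fromℕ K) * 1#              ≈⟨ *-congˡ OWA-X ⟨
        (w zero * fromℕ K) * OWA tight w X   ∎

theorem4 : ∀ {c ℓ₁ ℓ₂ p : Level} (𝔽 : OrderedField c ℓ₁ ℓ₂) →
    let open OrderedField 𝔽
        open OWA-Optimization 𝔽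
        open Instance using (Φ)
    in
    ∀ (k : ℕ) → let K = suc k in
    ∀ (w : Vector Carrier K) → IsWeightVector w → Nonincreasing w →
      (∀ {n : ℕ} (I : Instance n K p) (X̂ : Subset n) → IsMinimizer I (Ĉ I w) X̂ →
        ∀ (X : Subset n) → Φ I X → OWA I w X̂ ≤ (w zero * fromℕ K) * OWA I w X)
      ×
      (Σ[ n ∈ ℕ ] Σ[ I ∈ Instance n K p ] Σ[ X̂ ∈ Subset n ] Σ[ X ∈ Subset n ]
        (IsMinimizer I (Ĉ I w) X̂
        × Φ I X
        × 0# < OWA I w X
        × OWA I w X̂ ≈ (w zero * fromℕ K) * OWA I w X))
theorem4 {p = p} 𝔽 k w w-weights w↓ =
  (λ I X̂ → OWA-minimizer-bound I w-weights w↓) ,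
  -- There are `K + 1` elements: the expensive one and one for each scenario.
  (suc (suc k) , tight , X̂ , X ,
   X̂-minimizer w-weights w↓ , X∈Φ , 0<OWA-X w-weights w↓ , OWA-tight w-weights w↓)
  where
  open OWAProperties 𝔽
  open Tightness k p
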